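{- Let $k\geq 3$. There is no $k$-geodetic digraph with minimum out-degree at least $2$ and order $M(2,k)+2$ (where $M(2,k)=1+2+\dots+2^k$) whose in-degree sequence is $(1,1,2,\dots,2,3,3)$, i.e. exactly two vertices have in-degree $1$, exactly two have in-degree $3$, and all others have in-degree $2$.
   Context: A digraph is $k$-geodetic if for any two vertices $u,v$ there is at most one directed walk from $u$ to $v$ of length at most $k$. The in-degree sequence is the list of in-degrees in non-decreasing order. -}

module Defs where

open import Data.Nat using (ℕ; zero; suc; _+_; _*_; _^_; _≤_; _≡ᵇ_)
open import Data.Bool using (Bool; true; false; if_then_else_; T)
open import Data.Fin using (Fin)
open import Data.List using (List; map; allFin)
open import Data.Nat.ListAction using (sum)
open import Data.Product using (_×_)
open import Data.Sum using (_⊎_)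
open import Relation.Binary.PropositionalEquality using (_≡_)

M : ℕ → ℕ → ℕ
M d zero    = 1
M d (suc k) = M d k + d ^ suc k

-- A digraph on vertex set Fin n, given by its adjacency relation
-- (arc u → v iff A u v ≡ true).  Loops and parallel arcs are automatically
-- excluded by k-geodecity for k ≥ 1, so a Boolean adjacency matrix suffices.
Digraph : ℕ → Set
Digraph n = Fin n → Fin n → Bool

data Walk {n : ℕ} (A : Digraph n) : Fin n → Fin n → Set where
  []  : ∀ u → Walk A u u
  _∷_ : ∀ {u w v} → T (A u w) → Walk A w v → Walk A u v

walkLength : ∀ {n} {A : Digraph n} {u v} → Walk A u v → ℕ
walkLength ([] _)   = 0
walkLength (_ ∷ p) = suc (walkLength p)

KGeodetic : ∀ {n} → Digraph n → ℕ → Set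
KGeodetic {n} A k = ∀ (u v : Fin n) (p q : Walk A u v) →
  walkLength p ≤ k → walkLength q ≤ k → p ≡ q

b2n : Bool → ℕ
b2n true  = 1
b2n false = 0

outDeg : ∀ {n} → Digraph n → Fin n → ℕ
outDeg {n} A u = sum (map (λ v → b2n (A u v)) (allFin n))

inDeg : ∀ {n} → Digraph n → Fin n → ℕ
inDeg {n} A v = sum (map (λ u → b2n (A u v)) (allFin n))

numInDeg : ∀ {n} → Digraph n → ℕ → ℕ
numInDeg {n} A d = sum (map (λ v → b2n (inDeg A v ≡ᵇ d)) (allFin n))

InSeq11233 : ∀ {n} → Digraph n → Set
InSeq11233 {n} A =
  ((v : Fin n) → inDeg A v ≡ 1 ⊎ inDeg A v ≡ 2 ⊎ inDeg A v ≡ 3)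
  × numInDeg A 1 ≡ 2 × numInDeg A 3 ≡ 2

{-# OPTIONS --safe #-}
module Submission where

-- All out-degrees are 2, so every vertex u misses exactly two vertices, its outliers O(u),
-- within k steps.  Let z₁, z₂ have in-degree 1 and w₁, w₂ in-degree 3.  Counting paths of
-- length at most k + 1 from u, split at the first or at the last arc, gives an equality of
-- multisets, for u with out-neighbours u₁, u₂:
--   O(u₁) + O(u₂) + {w₁, w₂} = N⁺(O(u)) + {z₁, z₂}.
-- Hence O(u) always meets N⁻(w₁) and N⁻(w₂), and comparing the numbers of paths of length 1, 2
-- and 3 to w from the outliers shows that z₁ and z₂ are in-neighbours of both w₁ and w₂.
-- Let a and b be the third in-neighbours of w₁ and w₂.  If a = b, then O(w₁) consists of w₂
-- and an in-neighbour of w₁ and w₂, which is incompatible with any other in-neighbour of an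
-- out-neighbour of w₁.  If a ≠ b, then a and b have a common out-neighbour e, and the multiset
-- equality at a and at b gives O(e) = {z₁, z₂} and O(w₁) = N⁺(w₂); but O(w₁) meets N⁻(w₂),
-- so w₂ lies on a 2-cycle.

open import Defs
open import Data.Bool using (Bool; true; false; T)
open import Data.Empty using (⊥; ⊥-elim)
open import Data.Fin using (Fin; _≟_)
open import Data.List using (List; []; _∷_; _++_; map; length; filterᵇ; allFin)
open import Data.List.Membership.Propositional using (_∈_)
open import Data.List.Membership.Propositional.Properties
  using (∈-∃++; ∈-++⁺ˡ; ∈-++⁺ʳ; ∈-++⁻; ∈-allFin; ∈-filter⁺; ∈-filter⁻)
open import Data.List.Properties using (map-++; length-++; length-tabulate)
open import Data.List.Relation.Binary.Permutation.Propositional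
  using (_↭_; ↭-refl; ↭-sym; ↭-trans; ↭-prep; ↭⇒↭ₛ)
open import Data.List.Relation.Binary.Permutation.Propositional.Properties
  using (∈-resp-↭; map⁺; ↭-length; shift)
import Data.List.Relation.Binary.Permutation.Setoid.Properties as PermSetoid
open import Data.List.Relation.Unary.All as All using (All; []; _∷_)
open import Data.List.Relation.Unary.AllPairs using ([]; _∷_)
open import Data.List.Relation.Unary.Any using (here; there)
open import Data.List.Relation.Unary.Unique.Propositional using (Unique)
open import Data.List.Relation.Unary.Unique.Propositional.Properties
  using (allFin⁺; filter⁺; ++⁺)
open import Data.Nat using (ℕ; zero; suc; _+_; _*_; _^_; _≤_; _<_; z≤n; s≤s; _≡ᵇ_)
open import Data.Nat.ListAction using (sum)
open import Data.Nat.ListAction.Properties using (sum-++; sum-↭)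
open import Data.Nat.Properties hiding (_≟_)
open import Data.Nat.Tactic.RingSolver using (solve-∀)
open import Data.Product using (∃; ∃-syntax; _×_; _,_; proj₁; proj₂)
open import Data.Sum using (_⊎_; inj₁; inj₂; [_,_]′)
open import Function using (_∘_)
open import Relation.Binary.PropositionalEquality
open import Relation.Nullary using (¬_; yes; no; does; contradiction)
open import Relation.Nullary.Decidable using (T?)

private variable
  X Y : Set
  n : ℕ

-- Sums over lists.

∑ : (X → ℕ) → List X → ℕ
∑ f xs = sum (map f xs)

∑-++ : ∀ (f : X → ℕ) xs ys → ∑ f (xs ++ ys) ≡ ∑ f xs + ∑ f ys
∑-++ f xs ys = trans (cong sum (map-++ f xs ys)) (sum-++ (map f xs) (map f ys))

∑-↭ : ∀ (f : X → ℕ) {xs ys} → xs ↭ ys → ∑ f xs ≡ ∑ f ys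
∑-↭ f p = sum-↭ (map⁺ f p)

∑-cong : ∀ {f g : X → ℕ} → (∀ x → f x ≡ g x) → ∀ xs → ∑ f xs ≡ ∑ g xs
∑-cong f≗g []       = refl
∑-cong f≗g (x ∷ xs) = cong₂ _+_ (f≗g x) (∑-cong f≗g xs)

interchange : ∀ a b c d → (a + b) + (c + d) ≡ (a + c) + (b + d)
interchange = solve-∀

∑-+ : ∀ (f g : X → ℕ) xs → ∑ (λ x → f x + g x) xs ≡ ∑ f xs + ∑ g xs
∑-+ f g []       = refl
∑-+ f g (x ∷ xs) =
  trans (cong (f x + g x +_) (∑-+ f g xs)) (interchange (f x) (g x) (∑ f xs) (∑ g xs))

∑-0 : ∀ (xs : List X) → ∑ (λ _ → 0) xs ≡ 0
∑-0 []       = refl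
∑-0 (_ ∷ xs) = ∑-0 xs

∑-*ʳ : ∀ (f : X → ℕ) c xs → ∑ (λ x → f x * c) xs ≡ ∑ f xs * c
∑-*ʳ f c []       = refl
∑-*ʳ f c (x ∷ xs) =
  trans (cong (f x * c +_) (∑-*ʳ f c xs)) (sym (*-distribʳ-+ c (f x) (∑ f xs)))

∑-swap : ∀ (g : X → Y → ℕ) xs ys →
  ∑ (λ x → ∑ (g x) ys) xs ≡ ∑ (λ y → ∑ (λ x → g x y) xs) ys
∑-swap g []       ys = sym (∑-0 ys)
∑-swap g (x ∷ xs) ys =
  trans (cong (∑ (g x) ys +_) (∑-swap g xs ys)) (sym (∑-+ (g x) _ ys))

∑-filter : ∀ (f : X → ℕ) p xs → ∑ f (filterᵇ p xs) ≡ ∑ (λ x → b2n (p x) * f x) xs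
∑-filter f p []       = refl
∑-filter f p (x ∷ xs) with p x
... | true  = cong₂ _+_ (sym (+-identityʳ (f x))) (∑-filter f p xs)
... | false = ∑-filter f p xs

length-filter : ∀ (p : X → Bool) xs → length (filterᵇ p xs) ≡ ∑ (b2n ∘ p) xs
length-filter p []       = refl
length-filter p (x ∷ xs) with p x
... | true  = cong suc (length-filter p xs)
... | false = length-filter p xs

∑-mono : ∀ {f g : X → ℕ} → (∀ x → f x ≤ g x) → ∀ xs → ∑ f xs ≤ ∑ g xs
∑-mono f≤g []       = z≤n
∑-mono f≤g (x ∷ xs) = +-mono-≤ (f≤g x) (∑-mono f≤g xs)

-- If the pointwise larger function has no larger total, no term has any slack. This turns minimum
-- out-degree 2 into out-degree exactly 2.
∑-tight : ∀ {f g : X → ℕ} → (∀ x → f x ≤ g x) → ∀ {xs} → ∑ g xs ≤ ∑ f xs →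
  ∀ {x} → x ∈ xs → g x ≤ f x
∑-tight {f = f} {g} f≤g {x ∷ xs} le (here refl) =
  +-cancelʳ-≤ (∑ f xs) (g x) (f x)
    (≤-trans (+-monoʳ-≤ (g x) (∑-mono f≤g xs)) le)
∑-tight {f = f} {g} f≤g {y ∷ xs} le (there x∈xs) =
  ∑-tight f≤g (+-cancelˡ-≤ (f y) (∑ g xs) (∑ f xs)
    (≤-trans (+-monoˡ-≤ (∑ g xs) (f≤g y)) le)) x∈xs

-- Indicators, multiplicities and lists without repetition.

-- `∑ (δ v) xs` is the multiplicity of `v` in `xs`, so an identity of sums valid for all `f` is an
-- equality of multisets, read off at `f = δ v`.
δ : Fin n → Fin n → ℕ
δ v x = b2n (does (x ≟ v))

δ-refl : (v : Fin n) → δ v v ≡ 1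
δ-refl v with v ≟ v
... | yes _  = refl
... | no v≢v = contradiction refl v≢v

δ-≢ : {v x : Fin n} → x ≢ v → δ v x ≡ 0
δ-≢ {v = v} {x} x≢v with x ≟ v
... | yes x≡v = contradiction x≡v x≢v
... | no _    = refl

δ-pos : {v x : Fin n} → 1 ≤ δ v x → x ≡ v
δ-pos {v = v} {x} le with x ≟ v
... | yes x≡v = x≡v
δ-pos {v = v} {x} () | no _

pos-+ : ∀ m {l} → 1 ≤ m + l → 1 ≤ m ⊎ 1 ≤ l
pos-+ zero    le = inj₂ le
pos-+ (suc m) le = inj₁ (s≤s z≤n)

∈⇒∑δ : ∀ {v : Fin n} {xs} → v ∈ xs → 1 ≤ ∑ (δ v) xs
∈⇒∑δ {v = v} {x ∷ xs} (here refl) =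
  ≤-trans (≤-reflexive (sym (δ-refl v))) (m≤m+n _ _)
∈⇒∑δ {xs = x ∷ xs} (there v∈xs) = ≤-trans (∈⇒∑δ v∈xs) (m≤n+m _ _)

∑δ⇒∈ : ∀ {v : Fin n} {xs} → 1 ≤ ∑ (δ v) xs → v ∈ xs
∑δ⇒∈ {v = v} {x ∷ xs} le with pos-+ (δ v x) le
... | inj₁ p = here (sym (δ-pos p))
... | inj₂ p = there (∑δ⇒∈ p)

∑δ-unique : ∀ {v : Fin n} {xs} → Unique xs → ∑ (δ v) xs ≤ 1
∑δ-unique {xs = []}     u = z≤n
∑δ-unique {v = v} {x ∷ xs} (x∉ ∷ u) with x ≟ v
... | no _     = ∑δ-unique u
... | yes refl = s≤s (≮⇒≥ λ p → All.lookup x∉ (∑δ⇒∈ p) refl)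

-- Each entry of `xs` is moved to the front of `zs` and removed; later entries differ from it and
-- stay in the rest. This supplies the outliers and the third in-neighbours.
unique-⊆-complement : {xs zs : List X} → Unique xs → (∀ {x} → x ∈ xs → x ∈ zs) →
  ∃[ ys ] xs ++ ys ↭ zs
unique-⊆-complement {xs = []}     {zs} u        sub = zs , ↭-refl
unique-⊆-complement {xs = x ∷ xs} {zs} (x∉ ∷ u) sub
  with as , bs , refl ← ∈-∃++ (sub (here refl)) =
  let ys , p = unique-⊆-complement u λ y∈ →
                 drop-head (All.lookup x∉ y∈) (∈-resp-↭ (shift x as bs) (sub (there y∈)))
  in ys , ↭-trans (↭-prep x p) (↭-sym (shift x as bs))
  where
  drop-head : ∀ {y ws} → x ≢ y → y ∈ x ∷ ws → y ∈ ws
  drop-head x≢y (here y≡x)  = contradiction (sym y≡x) x≢y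
  drop-head x≢y (there y∈) = y∈

Unique-↭ : {xs ys : List X} → xs ↭ ys → Unique xs → Unique ys
Unique-↭ p = PermSetoid.Unique-resp-↭ (setoid _) (↭⇒↭ₛ p)

length-2 : ∀ (xs : List X) → length xs ≡ 2 → ∃[ x ] ∃[ y ] xs ≡ x ∷ y ∷ []
length-2 (x ∷ y ∷ []) refl = x , y , refl

-- Paths of fixed length and geodecity.

module Paths (A : Digraph n) where

  infix 4 _⟶_
  _⟶_ : Fin n → Fin n → Set
  u ⟶ v = T (A u v)

  -- Walks with the length as an index, which makes appending and removing a last arc direct.
  data Path : ℕ → Fin n → Fin n → Set where
    stop : ∀ {u} → Path 0 u u
    step : ∀ {j u w v} → u ⟶ w → Path j w v → Path (suc j) u v

  arc : ∀ {u v} → u ⟶ v → Path 1 u v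
  arc a = step a stop

  snoc : ∀ {j u w v} → Path j u w → w ⟶ v → Path (suc j) u v
  snoc stop       b = arc b
  snoc (step a p) b = step a (snoc p b)

  unsnoc : ∀ {j u v} → Path (suc j) u v → ∃[ w ] Path j u w × w ⟶ v
  unsnoc (step a stop)       = _ , stop , a
  unsnoc (step a (step b p)) = let w , q , c = unsnoc (step b p) in w , step a q , c

  toWalk : ∀ {j u v} → Path j u v → Walk A u v
  toWalk stop       = [] _
  toWalk (step a p) = a ∷ toWalk p

  walkLength-toWalk : ∀ {j u v} (p : Path j u v) → walkLength (toWalk p) ≡ j
  walkLength-toWalk stop       = refl
  walkLength-toWalk (step a p) = cong suc (walkLength-toWalk p)

  -- The value at the empty walk is a default; only walks with a first arc are compared.
  second : ∀ {u v} → Walk A u v → Fin n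
  second ([] u)          = u
  second (_∷_ {w = w} _ _) = w

  module Geodetic {k : ℕ} (geo : KGeodetic A k) where

    toWalk-unique : ∀ {i j u v} (p : Path i u v) (q : Path j u v) → i ≤ k → j ≤ k →
      toWalk p ≡ toWalk q
    toWalk-unique p q i≤k j≤k = geo _ _ (toWalk p) (toWalk q)
      (≤-trans (≤-reflexive (walkLength-toWalk p)) i≤k)
      (≤-trans (≤-reflexive (walkLength-toWalk q)) j≤k)

    same-length : ∀ {i j u v} → Path i u v → Path j u v → i ≤ k → j ≤ k → i ≡ j
    same-length p q i≤k j≤k =
      trans (sym (walkLength-toWalk p))
        (trans (cong walkLength (toWalk-unique p q i≤k j≤k)) (walkLength-toWalk q))

    no-cycle : ∀ {j u} → Path (suc j) u u → suc j ≤ k → ⊥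
    no-cycle p j≤k with () ← same-length p stop j≤k z≤n

    no-shortcut : ∀ {j u v} → Path (suc (suc j)) u v → suc (suc j) ≤ k → u ⟶ v → ⊥
    no-shortcut p j≤k a with () ← same-length p (arc a) j≤k (≤-trans (s≤s z≤n) j≤k)

    -- Prefixing the two arcs gives walks of length at most `k` with different second vertices.
    no-fork : ∀ {i j u x y v} → u ⟶ x → u ⟶ y → x ≢ y → Path i x v → Path j y v →
      i < k → j < k → ⊥
    no-fork a b x≢y p q i<k j<k =
      x≢y (cong second (toWalk-unique (step a p) (step b q) i<k j<k))

  -- Out-degree two: the adjacency operator and out-trees.

  module Binary (κ₁ κ₂ : Fin n → Fin n)
                (κ₁-arc : ∀ u → u ⟶ κ₁ u) (κ₂-arc : ∀ u → u ⟶ κ₂ u)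
                (κ₁≢κ₂ : ∀ u → κ₁ u ≢ κ₂ u)
                (κ-complete : ∀ {u v} → u ⟶ v → v ≡ κ₁ u ⊎ v ≡ κ₂ u) where

    -- The adjacency matrix applied to the column vector `f`; `K (δ v) u` counts the arcs from `u`
    -- to `v`.
    K : (Fin n → ℕ) → Fin n → ℕ
    K f u = f (κ₁ u) + f (κ₂ u)

    arc-Kδ : ∀ {u v} → 1 ≤ K (δ v) u → u ⟶ v
    arc-Kδ {u} {v} le with pos-+ (δ v (κ₁ u)) le
    ... | inj₁ p = subst (u ⟶_) (δ-pos p) (κ₁-arc u)
    ... | inj₂ p = subst (u ⟶_) (δ-pos p) (κ₂-arc u)

    sibling : ∀ {u s} → u ⟶ s → ∃[ t ] u ⟶ t × s ≢ t
    sibling {u} a with κ-complete a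
    ... | inj₁ refl = κ₂ u , κ₂-arc u , κ₁≢κ₂ u
    ... | inj₂ refl = κ₁ u , κ₁-arc u , κ₁≢κ₂ u ∘ sym

    no-third : ∀ {u s t v} → u ⟶ s → u ⟶ t → s ≢ t → u ⟶ v → v ≡ s ⊎ v ≡ t
    no-third a b s≢t c with κ-complete a | κ-complete b | κ-complete c
    ... | inj₁ p | inj₁ q | _      = contradiction (trans p (sym q)) s≢t
    ... | inj₂ p | inj₂ q | _      = contradiction (trans p (sym q)) s≢t
    ... | inj₁ p | inj₂ q | inj₁ r = inj₁ (trans r (sym p))
    ... | inj₁ p | inj₂ q | inj₂ r = inj₂ (trans r (sym q))
    ... | inj₂ p | inj₁ q | inj₁ r = inj₂ (trans r (sym q))
    ... | inj₂ p | inj₁ q | inj₂ r = inj₁ (trans r (sym p))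

    K-pair : ∀ {u s t} → u ⟶ s → u ⟶ t → s ≢ t → ∀ f → K f u ≡ f s + f t
    K-pair a b s≢t f with κ-complete a | κ-complete b
    ... | inj₁ refl | inj₁ refl = contradiction refl s≢t
    ... | inj₂ refl | inj₂ refl = contradiction refl s≢t
    ... | inj₁ refl | inj₂ refl = refl
    ... | inj₂ refl | inj₁ refl = +-comm (f _) (f _)

    -- The endpoints of all paths of length at most `j` from `u`, with multiplicity.
    tree : ℕ → Fin n → List (Fin n)
    tree zero    u = u ∷ []
    tree (suc j) u = u ∷ tree j (κ₁ u) ++ tree j (κ₂ u)

    M-suc : ∀ j → M 2 (suc j) ≡ suc (M 2 j + M 2 j)
    M-suc zero    = refl
    M-suc (suc j) =
      trans (cong (_+ 2 ^ suc (suc j)) (M-suc j)) (lemma (M 2 j) (2 ^ suc j))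
      where
      lemma : ∀ m p → suc (m + m) + (p + (p + 0)) ≡ suc ((m + p) + (m + p))
      lemma = solve-∀

    length-tree : ∀ j u → length (tree j u) ≡ M 2 j
    length-tree zero    u = refl
    length-tree (suc j) u = trans
      (cong suc (trans (length-++ (tree j (κ₁ u)))
                       (cong₂ _+_ (length-tree j (κ₁ u)) (length-tree j (κ₂ u)))))
      (sym (M-suc j))

    tree⇒path : ∀ j {u v} → v ∈ tree j u → ∃[ i ] i ≤ j × Path i u v
    tree⇒path zero    (here refl) = 0 , z≤n , stop
    tree⇒path (suc j) (here refl) = 0 , z≤n , stop
    tree⇒path (suc j) {u} (there v∈) with ∈-++⁻ (tree j (κ₁ u)) v∈
    ... | inj₁ p = let i , i≤j , q = tree⇒path j p in suc i , s≤s i≤j , step (κ₁-arc u) q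
    ... | inj₂ p = let i , i≤j , q = tree⇒path j p in suc i , s≤s i≤j , step (κ₂-arc u) q

    path⇒tree : ∀ {i j u v} → i ≤ j → Path i u v → v ∈ tree j u
    path⇒tree {j = zero}  z≤n       stop = here refl
    path⇒tree {j = suc j} z≤n       stop = here refl
    path⇒tree {j = suc j} {u} (s≤s i≤j) (step a p) with κ-complete a
    ... | inj₁ refl = there (∈-++⁺ˡ (path⇒tree i≤j p))
    ... | inj₂ refl = there (∈-++⁺ʳ (tree j (κ₁ u)) (path⇒tree i≤j p))

    ∑-tree-suc : ∀ f j u →
      ∑ f (tree (suc j) u) ≡ f u + (∑ f (tree j (κ₁ u)) + ∑ f (tree j (κ₂ u)))
    ∑-tree-suc f j u = cong (f u +_) (∑-++ f (tree j (κ₁ u)) (tree j (κ₂ u)))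

    -- Both sides sum `f` over the endpoints of the paths of length 1 to `j + 1` from `u`, split at
    -- the first arc on the left and at the last arc on the right.
    ∑-tree-K : ∀ f j u →
      ∑ f (tree j (κ₁ u)) + ∑ f (tree j (κ₂ u)) ≡ ∑ (K f) (tree j u)
    ∑-tree-K f zero    u = lemma (f (κ₁ u)) (f (κ₂ u))
      where
      lemma : ∀ a b → (a + 0) + (b + 0) ≡ (a + b) + 0
      lemma = solve-∀
    ∑-tree-K f (suc j) u = begin
      Σf (suc j) (κ₁ u) + Σf (suc j) (κ₂ u)
        ≡⟨ cong₂ _+_ (∑-tree-suc f j (κ₁ u)) (∑-tree-suc f j (κ₂ u)) ⟩
      (f (κ₁ u) + K (Σf j) (κ₁ u)) + (f (κ₂ u) + K (Σf j) (κ₂ u))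
        ≡⟨ interchange (f (κ₁ u)) _ (f (κ₂ u)) _ ⟩
      K f u + (K (Σf j) (κ₁ u) + K (Σf j) (κ₂ u))
        ≡⟨ cong (K f u +_) (cong₂ _+_ (∑-tree-K f j (κ₁ u)) (∑-tree-K f j (κ₂ u))) ⟩
      K f u + (∑ (K f) (tree j (κ₁ u)) + ∑ (K f) (tree j (κ₂ u)))
        ≡⟨ sym (∑-tree-suc (K f) j u) ⟩
      ∑ (K f) (tree (suc j) u) ∎
      where
      open ≡-Reasoning
      Σf : ℕ → Fin n → ℕ
      Σf i v = ∑ f (tree i v)

    -- Vertices within `k` steps.

    module GeodeticBinary {k : ℕ} (geo : KGeodetic A k) where
      open Geodetic geo public

      -- A repeated root would close a cycle, and a vertex common to the two subtrees would give a
      -- fork at `u`.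
      tree-unique : ∀ j → j ≤ k → ∀ u → Unique (tree j u)
      tree-unique zero    _   u = [] ∷ []
      tree-unique (suc j) j<k u =
        All.tabulate u∉ ∷ ++⁺ (tree-unique j (<⇒≤ j<k) (κ₁ u)) (tree-unique j (<⇒≤ j<k) (κ₂ u))
          λ (p , q) → let i , i≤j , p′ = tree⇒path j p
                          l , l≤j , q′ = tree⇒path j q
                      in no-fork (κ₁-arc u) (κ₂-arc u) (κ₁≢κ₂ u) p′ q′
                           (≤-<-trans i≤j j<k) (≤-<-trans l≤j j<k)
        where
        u∉ : ∀ {v} → v ∈ tree j (κ₁ u) ++ tree j (κ₂ u) → u ≢ v
        u∉ v∈ refl with ∈-++⁻ (tree j (κ₁ u)) v∈
        ... | inj₁ p = let i , i≤j , q = tree⇒path j p in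
                       no-cycle (step (κ₁-arc u) q) (≤-trans (s≤s i≤j) j<k)
        ... | inj₂ p = let i , i≤j , q = tree⇒path j p in
                       no-cycle (step (κ₂-arc u) q) (≤-trans (s≤s i≤j) j<k)

      Near : Fin n → Fin n → Set
      Near u v = ∃[ j ] j ≤ k × Path j u v

      -- Paths to `v` and to `t` must both leave `u` through its out-neighbour other than `s`:
      -- through `s`, the first closes a cycle with `v ⟶ s`, and the second forks at `v`.
      common-out-neighbour : ∀ {u v s t} → 2 ≤ k → u ≢ v → u ⟶ s → v ⟶ s → v ⟶ t → s ≢ t →
        Near u v → ¬ Near u t
      common-out-neighbour 2≤k u≢v us vs vt s≢t (_ , _ , stop) _ = u≢v refl
      common-out-neighbour 2≤k u≢v us vs vt s≢t (_ , _ , step _ _) (_ , _ , stop) =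
        no-shortcut (step vt (arc us)) 2≤k vs
      common-out-neighbour {u} {v} {s} 2≤k u≢v us vs vt s≢t
        (suc i , i<k , step {w = x} ux p) (suc j , j<k , step {w = y} uy q) with x ≟ s | y ≟ s
      ... | yes refl | _        = no-cycle (snoc p vs) i<k
      ... | no _     | yes refl = no-fork vs vt s≢t q stop j<k (<⇒≤ 2≤k)
      ... | no x≢s   | no y≢s with no-third us ux (x≢s ∘ sym) uy
      ...   | inj₁ y≡s  = y≢s y≡s
      -- Extending the path to `v` by `v ⟶ t` must give the length of the path to `t`. Hence `v` is
      -- reached in fewer than `k` steps, and the detour through `v` to `s` is still short enough to
      -- contradict `u ⟶ s`.
      ...   | inj₂ refl =
        no-shortcut (step ux (snoc p vs))
          (subst (_< k) (sym (same-length (snoc p vt) q i<k (<⇒≤ j<k))) j<k) us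

      -- The vertex found is the sibling of t on the path from u to t.
      far-sibling : ∀ {u v s r t} → 2 ≤ k → u ⟶ s → u ⟶ r → s ≢ r → v ⟶ s → v ⟶ t → s ≢ t →
        t ≢ r → Near u t → ∃[ x ] ∃[ j ] ¬ Near v x × suc (suc j) ≤ k × Path (suc j) r x
      far-sibling 2≤k us ur s≢r vs vt s≢t t≢r (_ , _ , stop) =
        ⊥-elim (no-shortcut (step vt (arc us)) 2≤k vs)
      far-sibling {v = v} 2≤k us ur s≢r vs vt s≢t t≢r (suc j , j<k , step uy q)
        with no-third us ur s≢r uy
      ... | inj₁ refl = ⊥-elim (no-fork vs vt s≢t q stop j<k (<⇒≤ 2≤k))
      far-sibling {v = v} 2≤k us ur s≢r vs vt s≢t t≢r (suc zero , j<k , step uy stop)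
          | inj₂ refl = contradiction refl t≢r
      far-sibling {v = v} 2≤k us ur s≢r vs vt s≢t t≢r (suc (suc j) , j<k , step uy q)
          | inj₂ refl with unsnoc q
      ... | p , q′ , pt with sibling pt
      ...   | x , px , t≢x = x , j , far , j<k , snoc q′ px
        where
        far : ¬ Near v x
        far (_ , _ , stop) = no-shortcut (step px (arc vt)) 2≤k pt
        -- Through `s`, the path forks at `u` with the one through the other out-neighbour; through
        -- `t`, it forks at the predecessor of `t` with the arc to `x`.
        far (suc i , i<k , step vc r) with no-third vs vt s≢t vc
        ... | inj₁ refl = no-fork us ur s≢r r (snoc q′ px) i<k j<k
        ... | inj₂ refl = no-fork pt px t≢x r stop i<k (<⇒≤ 2≤k)

      -- Outliers and the outlier identity.

      -- o₁ u and o₂ u are the vertices not reached from u within k steps; z₁, z₂ are the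
      -- vertices of in-degree 1 and w₁, w₂ those of in-degree 3.
      module Excess
        (3≤k : 3 ≤ k) (o₁ o₂ : Fin n → Fin n)
        (cover : ∀ u → tree k u ++ o₁ u ∷ o₂ u ∷ [] ↭ allFin n)
        {z₁ z₂ w₁ w₂ : Fin n} (z₁≢z₂ : z₁ ≢ z₂) (w₁≢w₂ : w₁ ≢ w₂)
        (handshake : ∀ f → ∑ (K f) (allFin n) + (f z₁ + f z₂)
                         ≡ (∑ f (allFin n) + ∑ f (allFin n)) + (f w₁ + f w₂))
        where

        2≤k : 2 ≤ k
        2≤k = <⇒≤ 3≤k

        1≤k : 1 ≤ k
        1≤k = <⇒≤ 2≤k

        O : (Fin n → ℕ) → Fin n → ℕ
        O f u = f (o₁ u) + f (o₂ u)

        Out : Fin n → Fin n → Set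
        Out u v = v ≡ o₁ u ⊎ v ≡ o₂ u

        ∑-tree-O : ∀ f u → ∑ f (tree k u) + O f u ≡ ∑ f (allFin n)
        ∑-tree-O f u = begin
          ∑ f (tree k u) + (f (o₁ u) + f (o₂ u))
            ≡⟨ cong (λ m → ∑ f (tree k u) + (f (o₁ u) + m)) (sym (+-identityʳ _)) ⟩
          ∑ f (tree k u) + ∑ f (o₁ u ∷ o₂ u ∷ [])
            ≡⟨ sym (∑-++ f (tree k u) _) ⟩
          ∑ f (tree k u ++ o₁ u ∷ o₂ u ∷ [])
            ≡⟨ ∑-↭ f (cover u) ⟩
          ∑ f (allFin n) ∎
          where open ≡-Reasoning

        -- With A the adjacency and P the outlier matrix, I + A + … + Aᵏ = J − P commutes
        -- with A; comparing A P with P A is this identity, applied to the column vector f.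
        outlier-identity : ∀ f u → K (O f) u + (f w₁ + f w₂) ≡ O (K f) u + (f z₁ + f z₂)
        outlier-identity f u = +-cancelˡ-≡ (K Σf u) _ _ (begin
          K Σf u + (K (O f) u + (f w₁ + f w₂))
            ≡⟨ sym (+-assoc (K Σf u) _ _) ⟩
          (K Σf u + K (O f) u) + (f w₁ + f w₂)
            ≡⟨ cong (_+ (f w₁ + f w₂)) (interchange (Σf (κ₁ u)) _ _ _) ⟩
          ((Σf (κ₁ u) + O f (κ₁ u)) + (Σf (κ₂ u) + O f (κ₂ u))) + (f w₁ + f w₂)
            ≡⟨ cong (_+ (f w₁ + f w₂)) (cong₂ _+_ (∑-tree-O f (κ₁ u)) (∑-tree-O f (κ₂ u))) ⟩
          (∑ f (allFin n) + ∑ f (allFin n)) + (f w₁ + f w₂)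
            ≡⟨ sym (handshake f) ⟩
          ∑ (K f) (allFin n) + (f z₁ + f z₂)
            ≡⟨ cong (_+ (f z₁ + f z₂)) (sym (∑-tree-O (K f) u)) ⟩
          (∑ (K f) (tree k u) + O (K f) u) + (f z₁ + f z₂)
            ≡⟨ cong (λ m → (m + O (K f) u) + (f z₁ + f z₂)) (sym (∑-tree-K f k u)) ⟩
          (K Σf u + O (K f) u) + (f z₁ + f z₂)
            ≡⟨ +-assoc (K Σf u) _ _ ⟩
          K Σf u + (O (K f) u + (f z₁ + f z₂)) ∎)
          where
          open ≡-Reasoning
          Σf : Fin n → ℕ
          Σf v = ∑ f (tree k v)

        near-or-out : ∀ u v → Near u v ⊎ Out u v
        near-or-out u v with ∈-++⁻ (tree k u) (∈-resp-↭ (↭-sym (cover u)) (∈-allFin v))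
        ... | inj₁ p                    = inj₁ (tree⇒path k p)
        ... | inj₂ (here v≡o₁)          = inj₂ (inj₁ v≡o₁)
        ... | inj₂ (there (here v≡o₂))  = inj₂ (inj₂ v≡o₂)

        far⇒out : ∀ {u v} → ¬ Near u v → Out u v
        far⇒out {u} {v} far with near-or-out u v
        ... | inj₁ near = contradiction near far
        ... | inj₂ out  = out

        -- This bound separates reached vertices from outliers, and the two outliers from each
        -- other.
        covered-once : ∀ u v → ∑ (δ v) (tree k u) + O (δ v) u ≤ 1
        covered-once u v =
          ≤-trans (≤-reflexive (∑-tree-O (δ v) u)) (∑δ-unique (allFin⁺ n))

        Out-Oδ : ∀ {u v} → Out u v → 1 ≤ O (δ v) u
        Out-Oδ {v = v} (inj₁ refl) = ≤-trans (≤-reflexive (sym (δ-refl v))) (m≤m+n _ _)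
        Out-Oδ {v = v} (inj₂ refl) = ≤-trans (≤-reflexive (sym (δ-refl v))) (m≤n+m _ _)

        out⇒far : ∀ {u v} → Out u v → ¬ Near u v
        out⇒far {u} {v} out (i , i≤k , p) =
          contradiction (≤-trans (+-mono-≤ (∈⇒∑δ (path⇒tree i≤k p)) (Out-Oδ out))
                                 (covered-once u v))
                        λ { (s≤s ()) }

        o₁≢o₂ : ∀ u → o₁ u ≢ o₂ u
        o₁≢o₂ u eq =
          contradiction (≤-trans (≤-trans (+-mono-≤ (at refl) (at (sym eq))) (m≤n+m _ (∑ (δ (o₁ u)) (tree k u))))
                                 (covered-once u (o₁ u)))
                        λ { (s≤s ()) }
          where
          at : ∀ {v} → v ≡ o₁ u → 1 ≤ δ (o₁ u) v
          at refl = ≤-reflexive (sym (δ-refl (o₁ u)))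

        O-pair : ∀ {u x y} → Out u x → Out u y → x ≢ y → ∀ f → O f u ≡ f x + f y
        O-pair (inj₁ refl) (inj₁ refl) x≢y f = contradiction refl x≢y
        O-pair (inj₂ refl) (inj₂ refl) x≢y f = contradiction refl x≢y
        O-pair (inj₁ refl) (inj₂ refl) x≢y f = refl
        O-pair (inj₂ refl) (inj₁ refl) x≢y f = +-comm (f (o₁ _)) (f (o₂ _))

        out-pair : ∀ {u x y v} → Out u x → Out u y → x ≢ y → Out u v → v ≡ x ⊎ v ≡ y
        out-pair {x = x} {y} {v} p q x≢y r
          with pos-+ (δ v x) (subst (1 ≤_) (O-pair p q x≢y (δ v)) (Out-Oδ r))
        ... | inj₁ le = inj₁ (sym (δ-pos le))
        ... | inj₂ le = inj₂ (sym (δ-pos le))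

        no-three-out : ∀ {u x y v} → Out u x → Out u y → Out u v →
          x ≢ y → v ≢ x → v ≢ y → ⊥
        no-three-out p q r x≢y v≢x v≢y = [ v≢x , v≢y ]′ (out-pair p q x≢y r)

        -- The vertices of in-degree 1 as in-neighbours of those of in-degree 3.

        module InDegreeThree {w : Fin n} (z₁≢w : z₁ ≢ w) (z₂≢w : z₂ ≢ w)
                             (w∈ : ∀ (f : Fin n → ℕ) → f w ≤ f w₁ + f w₂) where

          -- The numbers of paths of length 1, 2 and 3 to w.
          W D E : Fin n → ℕ
          W = K (δ w)
          D = K W
          E = K D

          -- In the outlier identity for `δ w`, the left side counts `w` itself, while `z₁` and `z₂`
          -- contribute nothing on the right.
          hit-≤ : ∀ u → 1 ≤ O W u
          hit-≤ u = begin
            1                                      ≡⟨ sym (δ-refl w) ⟩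
            δ w w                                  ≤⟨ w∈ (δ w) ⟩
            δ w w₁ + δ w w₂                        ≤⟨ m≤n+m _ (K (O (δ w)) u) ⟩
            K (O (δ w)) u + (δ w w₁ + δ w w₂)      ≡⟨ outlier-identity (δ w) u ⟩
            O W u + (δ w z₁ + δ w z₂)              ≡⟨ cong (O W u +_)
                                                        (cong₂ _+_ (δ-≢ z₁≢w) (δ-≢ z₂≢w)) ⟩
            O W u + 0                              ≡⟨ +-identityʳ _ ⟩
            O W u                                  ∎
            where open ≤-Reasoning

          hit : ∀ u → ∃[ o ] Out u o × o ⟶ w
          hit u with pos-+ (W (o₁ u)) (hit-≤ u)
          ... | inj₁ le = o₁ u , inj₁ refl , arc-Kδ le
          ... | inj₂ le = o₂ u , inj₂ refl , arc-Kδ le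

          -- As `3 ≤ k`, at most one path of length at most 3 leads from `x` to `w`.
          W+D+E≤1 : ∀ x → W x + (D x + E x) ≤ 1
          W+D+E≤1 x = begin
            W x + (D x + E x)                      ≤⟨ m≤n+m _ (δ w x) ⟩
            δ w x + (W x + (D x + E x))            ≡⟨ cong (λ m → δ w x + (W x + (D x + m)))
                                                        (sym (+-identityʳ _)) ⟩
            δ w x + (W x + (D x + (E x + 0)))      ≡⟨ sym (expand (δ w) x) ⟩
            ∑ (δ w) (tree 3 x)                     ≤⟨ ∑δ-unique (tree-unique 3 3≤k x) ⟩
            1                                      ∎
            where
            open ≤-Reasoning
            ∑-suc : ∀ f j u → ∑ f (tree (suc j) u) ≡ f u + ∑ (K f) (tree j u)
            ∑-suc f j u = trans (∑-tree-suc f j u) (cong (f u +_) (∑-tree-K f j u))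
            expand : ∀ f u → ∑ f (tree 3 u) ≡ f u + (K f u + (K (K f) u + (K (K (K f)) u + 0)))
            expand f u = trans (∑-suc f 2 u) (cong (f u +_)
                        (trans (∑-suc (K f) 1 u) (cong (K f u +_) (∑-suc (K (K f)) 0 u))))

          O[W+D+E]≤2 : ∀ u → O W u + (O D u + O E u) ≤ 2
          O[W+D+E]≤2 u = ≤-trans
            (≤-reflexive (lemma (W (o₁ u)) (W (o₂ u)) (D (o₁ u)) (D (o₂ u)) (E (o₁ u)) (E (o₂ u))))
            (+-mono-≤ (W+D+E≤1 (o₁ u)) (W+D+E≤1 (o₂ u)))
            where
            lemma : ∀ a b c d e f →
              (a + b) + ((c + d) + (e + f)) ≡ (a + (c + e)) + (b + (d + f))
            lemma = solve-∀

          lift : ∀ f u → K (O f) u ≤ O (K f) u + (f z₁ + f z₂)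
          lift f u = ≤-trans (m≤m+n _ _) (≤-reflexive (outlier-identity f u))

          -- Each out-neighbour of `u` has an outlier adjacent to `w`; the outlier identity for `W`
          -- transfers both units to the right side.
          2≤OD+Wz : ∀ u → 2 ≤ O D u + (W z₁ + W z₂)
          2≤OD+Wz u = ≤-trans (+-mono-≤ (hit-≤ (κ₁ u)) (hit-≤ (κ₂ u))) (lift W u)

          -- Otherwise every outlier pair has one vertex at distance 1 and the other at
          -- distance 2 from w, so that D sums to 2 on the outliers of κ₁ u and κ₂ u; by the
          -- outlier identity for D, both z₁ and z₂ then have an out-neighbour adjacent
          -- to w, so neither is adjacent to w itself and D is too large on O(z₁).
          2≤Wz : 2 ≤ W z₁ + W z₂
          2≤Wz = ≮⇒≥ λ Wz<2 →
            let 1≤OD : ∀ u → 1 ≤ O D u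
                1≤OD u = +-cancelʳ-≤ 1 1 (O D u)
                           (≤-trans (2≤OD+Wz u) (+-monoʳ-≤ (O D u) (≤-pred Wz<2)))
                OE≤0 : ∀ u → O E u ≤ 0
                OE≤0 u = +-cancelˡ-≤ 2 (O E u) 0
                           (≤-trans (+-mono-≤ (hit-≤ u) (+-monoˡ-≤ (O E u) (1≤OD u)))
                                    (O[W+D+E]≤2 u))
                2≤Dz : 2 ≤ D z₁ + D z₂
                2≤Dz = ≤-trans (+-mono-≤ (1≤OD (κ₁ z₁)) (1≤OD (κ₂ z₁)))
                         (≤-trans (lift D z₁) (+-monoˡ-≤ (D z₁ + D z₂) (OE≤0 z₁)))
                Wz≤0 : W z₁ + W z₂ ≤ 0
                Wz≤0 = +-cancelʳ-≤ 2 (W z₁ + W z₂) 0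
                         (≤-trans (+-monoʳ-≤ (W z₁ + W z₂) 2≤Dz) W+Dz≤2)
                2≤OD = ≤-trans (2≤OD+Wz z₁)
                         (≤-trans (+-monoʳ-≤ (O D z₁) Wz≤0) (≤-reflexive (+-identityʳ _)))
            in contradiction
                 (≤-trans (+-mono-≤ (hit-≤ z₁) (≤-trans 2≤OD (m≤m+n _ (O E z₁))))
                          (O[W+D+E]≤2 z₁))
                 λ { (s≤s (s≤s ())) }
            where
            W+D≤1 : ∀ x → W x + D x ≤ 1
            W+D≤1 x = ≤-trans (+-monoʳ-≤ (W x) (m≤m+n _ (E x))) (W+D+E≤1 x)
            W+Dz≤2 : (W z₁ + W z₂) + (D z₁ + D z₂) ≤ 2
            W+Dz≤2 = ≤-trans (≤-reflexive (interchange (W z₁) _ _ _))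
                              (+-mono-≤ (W+D≤1 z₁) (W+D≤1 z₂))

          W≤1 : ∀ x → W x ≤ 1
          W≤1 x = ≤-trans (m≤m+n _ _) (W+D+E≤1 x)

          z₁⟶w : z₁ ⟶ w
          z₁⟶w = arc-Kδ (+-cancelʳ-≤ 1 1 (W z₁) (≤-trans 2≤Wz (+-monoʳ-≤ (W z₁) (W≤1 z₂))))

          z₂⟶w : z₂ ⟶ w
          z₂⟶w = arc-Kδ (+-cancelˡ-≤ 1 1 (W z₂) (≤-trans 2≤Wz (+-monoˡ-≤ (W z₂) (W≤1 z₁))))

        -- Outliers around a third in-neighbour.

        IsZ : Fin n → Set
        IsZ z = z ≡ z₁ ⊎ z ≡ z₂

        other-z : ∀ {z} → IsZ z → ∃[ z′ ] IsZ z′ × z ≢ z′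
        other-z (inj₁ refl) = z₂ , inj₂ refl , z₁≢z₂
        other-z (inj₂ refl) = z₁ , inj₁ refl , z₁≢z₂ ∘ sym

        -- A path from `c` to `c′` starts through `w` or `w′`, and an arc from `c′` closes it to a
        -- cycle there.
        twin-out : ∀ {w w′ c c′} → w ≢ w′ → c ⟶ w → c ⟶ w′ → c′ ⟶ w → c′ ⟶ w′ → c ≢ c′ → Out c c′
        twin-out {c = c} {c′} w≢w′ cw cw′ c′w c′w′ c≢c′ = far⇒out far
          where
          far : ¬ Near c c′
          far (_ , _ , stop)            = c≢c′ refl
          far (suc i , i<k , step cx p) with no-third cw cw′ w≢w′ cx
          ... | inj₁ refl = no-cycle (snoc p c′w) i<k
          ... | inj₂ refl = no-cycle (snoc p c′w′) i<k

        -- w and w′ are w₁ and w₂ in either order, a is the third in-neighbour of w, and e is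
        -- the other out-neighbour of a.
        module ThirdInNeighbour
          {w w′ a e : Fin n} (w≢w′ : w ≢ w′)
          (hit : ∀ u → ∃[ o ] Out u o × o ⟶ w)
          (w+w′ : ∀ (f : Fin n → ℕ) → f w + f w′ ≡ f w₁ + f w₂)
          (zw : ∀ {z} → IsZ z → z ⟶ w) (zw′ : ∀ {z} → IsZ z → z ⟶ w′)
          (in-w : ∀ {x} → x ⟶ w → IsZ x ⊎ x ≡ a)
          (aw : a ⟶ w) (a∉Z : ¬ IsZ a) (a↛w′ : ¬ (a ⟶ w′))
          (ae : a ⟶ e) (w≢e : w ≢ e)
          where

          z≢w′ : ∀ {z} → IsZ z → z ≢ w′
          z≢w′ z refl = no-cycle (arc (zw′ z)) 1≤k

          z-out : ∃[ z ] IsZ z × Out a z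
          z-out with hit a
          ... | o , out , ow with in-w ow
          ...   | inj₁ z    = o , z , out
          ...   | inj₂ refl = ⊥-elim (out⇒far out (0 , z≤n , stop))

          -- `a` and `z` share the out-neighbour `w`, and `w′` is the other one of `z`; so `a`
          -- cannot reach both `z` and `w′`.
          z-or-w′-out : ∀ {z} → IsZ z → Out a z ⊎ Out a w′
          z-or-w′-out {z} isZ with near-or-out a z | near-or-out a w′
          ... | inj₂ out | _        = inj₁ out
          ... | _        | inj₂ out = inj₂ out
          ... | inj₁ p   | inj₁ q   =
            ⊥-elim (common-out-neighbour 2≤k (λ { refl → a∉Z isZ }) aw (zw isZ) (zw′ isZ) w≢w′ p q)

          -- The outliers of `a` are `z₁` and `z₂`, or one of these and `w′`. Any of them below `w′`
          -- would close a cycle through `w′`; the extra step in the bound pays for the arc from a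
          -- `z`.
          not-below-w′ : ∀ {x j} → Out a x → suc (suc j) ≤ k → Path (suc j) w′ x → ⊥
          not-below-w′ {x} x-out j<k p with z-out
          ... | z , isZ , out with other-z isZ
          ...   | z′ , isZ′ , z≢z′ with z-or-w′-out isZ′
          ...     | inj₁ out′ = no-three-out out out′ x-out z≢z′ (x≢z isZ) (x≢z isZ′)
            where
            x≢z : ∀ {y} → IsZ y → x ≢ y
            x≢z isY refl = no-cycle (snoc p (zw′ isY)) j<k
          ...     | inj₂ out′ = no-three-out out out′ x-out (z≢w′ isZ)
                                  (λ { refl → no-cycle (snoc p (zw′ isZ)) j<k })
                                  (λ { refl → no-cycle p (<⇒≤ j<k) })

          -- If `z` reached `e`, then `far-sibling` would yield an outlier of `a` below `w′`.
          e-out : ∀ {z} → IsZ z → Out z e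
          e-out isZ = far⇒out λ near →
            let x , j , far , j<k , p = far-sibling 2≤k (zw isZ) (zw′ isZ) w≢w′ aw ae w≢e
                                          (λ { refl → a↛w′ ae }) near
            in not-below-w′ (far⇒out far) j<k p

          e≢z : ∀ {z} → IsZ z → e ≢ z
          e≢z isZ refl = no-shortcut (step ae (arc (zw isZ))) 2≤k aw

          module _ {b} (a≢b : a ≢ b) (b∉Z : ¬ IsZ b) (bw′ : b ⟶ w′) (be : b ⟶ e) where

            -- `a` and `b` share `e`, so `a` misses `b` or `w′`. If it misses `b` and one `z`, there
            -- is no room for the other `z`, and `z-or-w′-out` gives `w′`.
            w′-out : Out a w′
            w′-out with near-or-out a b | near-or-out a w′ | z-out
            ... | _       | inj₂ out | _ = out
            ... | inj₁ p  | inj₁ q   | _ =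
              ⊥-elim (common-out-neighbour 2≤k a≢b ae be bw′ (λ { refl → a↛w′ ae }) p q)
            ... | inj₂ out | inj₁ _  | z₀ , isZ₀ , out₀ with other-z isZ₀
            ...   | z₁ , isZ₁ , z₀≢z₁ with z-or-w′-out isZ₁
            ...     | inj₂ out′ = out′
            ...     | inj₁ out₁ = ⊥-elim (no-three-out out₀ out₁ out z₀≢z₁
                                      (λ { refl → b∉Z isZ₀ }) (λ { refl → b∉Z isZ₁ }))

            -- The outliers of `a` are a `z` and `w′`. In the outlier identity at `a`, the
            -- out-neighbours of that `z` cancel against `w₁` and `w₂`.
            O-w-e : ∀ f → O f w + O f e ≡ K f w′ + (f z₁ + f z₂)
            O-w-e f = +-cancelʳ-≡ (f w₁ + f w₂) _ _ (begin
              (O f w + O f e) + (f w₁ + f w₂)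
                ≡⟨ cong (_+ (f w₁ + f w₂)) (sym (K-pair aw ae w≢e (O f))) ⟩
              K (O f) a + (f w₁ + f w₂)
                ≡⟨ outlier-identity f a ⟩
              O (K f) a + (f z₁ + f z₂)
                ≡⟨ cong (_+ (f z₁ + f z₂)) (O-pair out₀ w′-out (z≢w′ isZ₀) (K f)) ⟩
              (K f z₀ + K f w′) + (f z₁ + f z₂)
                ≡⟨ cong (λ m → (m + K f w′) + (f z₁ + f z₂))
                     (trans (K-pair (zw isZ₀) (zw′ isZ₀) w≢w′ f) (w+w′ f)) ⟩
              ((f w₁ + f w₂) + K f w′) + (f z₁ + f z₂)
                ≡⟨ rotate (f w₁ + f w₂) (K f w′) (f z₁ + f z₂) ⟩
              (K f w′ + (f z₁ + f z₂)) + (f w₁ + f w₂) ∎)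
              where
              open ≡-Reasoning
              z₀ = proj₁ z-out
              isZ₀ = proj₁ (proj₂ z-out)
              out₀ = proj₂ (proj₂ z-out)
              rotate : ∀ a b c → (a + b) + c ≡ (b + c) + a
              rotate = solve-∀

        z-pair : ∀ {x y} → IsZ x → IsZ y → x ≢ y → ∀ (f : Fin n → ℕ) → f x + f y ≡ f z₁ + f z₂
        z-pair (inj₁ refl) (inj₁ refl) x≢y f = contradiction refl x≢y
        z-pair (inj₂ refl) (inj₂ refl) x≢y f = contradiction refl x≢y
        z-pair (inj₁ refl) (inj₂ refl) x≢y f = refl
        z-pair (inj₂ refl) (inj₁ refl) x≢y f = +-comm (f z₂) (f z₁)

        δ-z : ∀ {x} → 1 ≤ δ x z₁ + δ x z₂ → IsZ x
        δ-z {x} le with pos-+ (δ x z₁) le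
        ... | inj₁ le₁ = inj₁ (sym (δ-pos le₁))
        ... | inj₂ le₂ = inj₂ (sym (δ-pos le₂))

        ThirdInNeighbourOf : Fin n → Fin n → Set
        ThirdInNeighbourOf w a = a ⟶ w × ¬ IsZ a × (∀ {x} → x ⟶ w → IsZ x ⊎ x ≡ a)

        module InDegreesThree
          (zw₁ : ∀ {z} → IsZ z → z ⟶ w₁) (zw₂ : ∀ {z} → IsZ z → z ⟶ w₂)
          (hit₁ : ∀ u → ∃[ o ] Out u o × o ⟶ w₁) (hit₂ : ∀ u → ∃[ o ] Out u o × o ⟶ w₂)
          where

          no-common-out : ∀ {x} → w₁ ⟶ x → w₂ ⟶ x → ⊥
          no-common-out w₁x w₂x =
            no-fork (zw₁ (inj₁ refl)) (zw₂ (inj₁ refl)) w₁≢w₂ (arc w₁x) (arc w₂x) 2≤k 2≤k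

          w₂↛w₁ : ¬ (w₂ ⟶ w₁)
          w₂↛w₁ w₂w₁ =
            no-shortcut (step (zw₂ (inj₁ refl)) (arc w₂w₁)) 2≤k (zw₁ (inj₁ refl))

          -- Coinciding third in-neighbours.

          module _ (to : ∀ {x} → x ⟶ w₁ → x ⟶ w₂) (from : ∀ {x} → x ⟶ w₂ → x ⟶ w₁) where

            w₂-out : Out w₁ w₂
            w₂-out = far⇒out far
              where
              far : ¬ Near w₁ w₂
              far (_ , _ , stop)               = w₁≢w₂ refl
              far (suc i , i<k , p@(step _ _)) =
                let x , q , xw₂ = unsnoc p in no-cycle (snoc q (from xw₂)) i<k

            -- The outliers of `w₁` are `c` and `w₂`. Neither `s` nor `t` is one of them, so `w₁`
            -- reaches both, against `common-out-neighbour`.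
            no-shared-child : ∀ {r s t c} → w₁ ⟶ r → w₁ ≢ s → s ⟶ r → s ⟶ t → r ≢ t →
              Out w₁ c → c ⟶ w₁ → ⊥
            no-shared-child {r} {s} {t} {c} w₁r w₁≢s sr st r≢t c-out cw₁ =
              common-out-neighbour 2≤k w₁≢s w₁r sr st r≢t
                (near (λ { refl → s↛w₁ cw₁ }) (λ { refl → no-common-out w₁r sr }))
                (near (λ { refl → no-shortcut (step st (step cw₁ (arc w₁r))) 3≤k sr })
                      (λ { refl → s↛w₁ (from st) }))
              where
              s↛w₁ : ¬ (s ⟶ w₁)
              s↛w₁ sw₁ with no-third sw₁ (to sw₁) w₁≢w₂ sr
              ... | inj₁ refl = no-cycle (arc w₁r) 1≤k
              ... | inj₂ refl = no-cycle (arc (from w₁r)) 1≤k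

              near : ∀ {x} → x ≢ c → x ≢ w₂ → Near w₁ x
              near {x} x≢c x≢w₂ with near-or-out w₁ x
              ... | inj₁ p   = p
              ... | inj₂ out =
                ⊥-elim (no-three-out c-out w₂-out out (λ { refl → w₂↛w₁ cw₁ }) x≢c x≢w₂)

            no-twins : (∀ {r} → ¬ IsZ r → ∀ x → ∃[ s ] x ≢ s × s ⟶ r) → ⊥
            no-twins another-in =
              let w₁r = κ₁-arc w₁
                  -- `r` has a second in-neighbour: were it `z₁` or `z₂`, its arc to `w₁` would
                  -- close a 2-cycle.
                  s , w₁≢s , sr = another-in (λ isZ → no-cycle (step w₁r (arc (zw₁ isZ))) 2≤k) w₁
                  t , st , r≢t = sibling sr
                  c , c-out , cw₁ = hit₁ w₁
              in no-shared-child w₁r w₁≢s sr st r≢t c-out cw₁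

          -- Distinct third in-neighbours.

          module Distinct {a b e e′}
            (a-third : ThirdInNeighbourOf w₁ a) (b-third : ThirdInNeighbourOf w₂ b) (a≢b : a ≢ b)
            (ae : a ⟶ e) (w₁≢e : w₁ ≢ e) (be′ : b ⟶ e′) (w₂≢e′ : w₂ ≢ e′)
            where

            aw₁ = proj₁ a-third
            a∉Z = proj₁ (proj₂ a-third)
            bw₂ = proj₁ b-third
            b∉Z = proj₁ (proj₂ b-third)

            module A = ThirdInNeighbour w₁≢w₂ hit₁ (λ f → refl) zw₁ zw₂ (proj₂ (proj₂ a-third))
                         aw₁ a∉Z ([ a∉Z , a≢b ]′ ∘ proj₂ (proj₂ b-third)) ae w₁≢e
            module B = ThirdInNeighbour (w₁≢w₂ ∘ sym) hit₂ (λ f → +-comm (f w₂) (f w₁))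
                         zw₂ zw₁ (proj₂ (proj₂ b-third))
                         bw₂ b∉Z ([ b∉Z , a≢b ∘ sym ]′ ∘ proj₂ (proj₂ a-third)) be′ w₂≢e′

            z₂-out : Out z₁ z₂
            z₂-out = twin-out w₁≢w₂ (zw₁ (inj₁ refl)) (zw₂ (inj₁ refl))
                       (zw₁ (inj₂ refl)) (zw₂ (inj₂ refl)) z₁≢z₂

            -- The outliers of `z₁` are `z₂` and `e`; `e′` is an outlier of `z₁` too, and not `z₂`.
            e′≡e : e′ ≡ e
            e′≡e = [ (λ e′≡z₂ → contradiction e′≡z₂ (B.e≢z (inj₂ refl))) , (λ eq → eq) ]′
                   (out-pair z₂-out (A.e-out (inj₁ refl)) (A.e≢z (inj₂ refl) ∘ sym)
                             (B.e-out (inj₁ refl)))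

            O-w₁-e : ∀ f → O f w₁ + O f e ≡ K f w₂ + (f z₁ + f z₂)
            O-w₁-e = A.O-w-e a≢b b∉Z bw₂ (subst (b ⟶_) e′≡e be′)

            O-w₂-e : ∀ f → O f w₂ + O f e ≡ K f w₁ + (f z₁ + f z₂)
            O-w₂-e f = subst (λ x → O f w₂ + O f x ≡ K f w₁ + (f z₁ + f z₂)) e′≡e
              (B.O-w-e (a≢b ∘ sym) a∉Z aw₁ (subst (a ⟶_) (sym e′≡e) ae) f)

            out-of-e : ∀ {x y y′} → (∀ f → O f y + O f e ≡ K f y′ + (f z₁ + f z₂)) →
              Out e x → y′ ⟶ x ⊎ IsZ x
            out-of-e {x} {y} {y′} eq out with pos-+ (K (δ x) y′)
              (≤-trans (Out-Oδ out) (≤-trans (m≤n+m _ (O (δ x) y)) (≤-reflexive (eq (δ x)))))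
            ... | inj₁ le = inj₁ (arc-Kδ le)
            ... | inj₂ le = inj₂ (δ-z le)

            -- By the two multiset equalities, any other outlier of `e` would be a common
            -- out-neighbour of `w₁` and `w₂`.
            out-e : ∀ {x} → Out e x → IsZ x
            out-e out =
              [ (λ w₂x → [ (λ w₁x → ⊥-elim (no-common-out w₁x w₂x)) , (λ isZ → isZ) ]′
                         (out-of-e O-w₂-e out))
              , (λ isZ → isZ) ]′ (out-of-e O-w₁-e out)

            O-w₁ : ∀ f → O f w₁ ≡ K f w₂
            O-w₁ f = +-cancelʳ-≡ (f z₁ + f z₂) _ _
              (trans (cong (O f w₁ +_)
                           (sym (z-pair (out-e (inj₁ refl)) (out-e (inj₂ refl)) (o₁≢o₂ e) f)))
                     (O-w₁-e f))

            absurd : ⊥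
            absurd =
              let o , out , ow₂ = hit₂ w₁
                  w₂o = arc-Kδ (subst (1 ≤_) (O-w₁ (δ o)) (Out-Oδ out))
              in no-cycle (step w₂o (arc ow₂)) 2≤k

          impossible : (∀ {r} → ¬ IsZ r → ∀ x → ∃[ s ] x ≢ s × s ⟶ r) →
            ∃ (ThirdInNeighbourOf w₁) → ∃ (ThirdInNeighbourOf w₂) → ⊥
          impossible another-in (a , aw₁ , a∉Z , in-w₁) (b , bw₂ , b∉Z , in-w₂)
            with a ≟ b | sibling aw₁ | sibling bw₂
          ... | yes refl | _ | _ = no-twins ([ zw₂ , (λ { refl → bw₂ }) ]′ ∘ in-w₁)
                                            ([ zw₁ , (λ { refl → aw₁ }) ]′ ∘ in-w₂) another-in
          ... | no a≢b | _ , ae , w₁≢e | _ , be′ , w₂≢e′ =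
            Distinct.absurd (aw₁ , a∉Z , in-w₁) (bw₂ , b∉Z , in-w₂) a≢b ae w₁≢e be′ w₂≢e′

        no-excess-two :
          (∀ {z} → IsZ z → z ≢ w₁) → (∀ {z} → IsZ z → z ≢ w₂) →
          (∀ {r} → ¬ IsZ r → ∀ x → ∃[ s ] x ≢ s × s ⟶ r) →
          (∀ {w} → w ≡ w₁ ⊎ w ≡ w₂ → (∀ {z} → IsZ z → z ⟶ w) → ∃ (ThirdInNeighbourOf w)) →
          ⊥
        no-excess-two z≢w₁ z≢w₂ another-in third-in =
          InDegreesThree.impossible zw₁ zw₂ I₁.hit I₂.hit another-in
            (third-in (inj₁ refl) zw₁) (third-in (inj₂ refl) zw₂)
          where
          module I₁ = InDegreeThree {w₁} (z≢w₁ (inj₁ refl)) (z≢w₁ (inj₂ refl))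
                        (λ f → m≤m+n (f w₁) (f w₂))
          module I₂ = InDegreeThree {w₂} (z≢w₂ (inj₁ refl)) (z≢w₂ (inj₂ refl))
                        (λ f → m≤n+m (f w₂) (f w₁))

          zw₁ : ∀ {z} → IsZ z → z ⟶ w₁
          zw₁ (inj₁ refl) = I₁.z₁⟶w
          zw₁ (inj₂ refl) = I₁.z₂⟶w

          zw₂ : ∀ {z} → IsZ z → z ⟶ w₂
          zw₂ (inj₁ refl) = I₂.z₁⟶w
          zw₂ (inj₂ refl) = I₂.z₂⟶w

      -- The tree has `M 2 k` distinct entries, so its complement has two.
      outliers : n ≡ M 2 k + 2 → ∀ u → ∃[ a ] ∃[ b ] tree k u ++ a ∷ b ∷ [] ↭ allFin n
      outliers n≡ u with unique-⊆-complement (tree-unique k ≤-refl u) (λ {x} _ → ∈-allFin x)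
      ... | ys , p with length-2 ys (+-cancelˡ-≡ (M 2 k) _ _ (begin
          M 2 k + length ys              ≡⟨ cong (_+ length ys) (sym (length-tree k u)) ⟩
          length (tree k u) + length ys  ≡⟨ sym (length-++ (tree k u)) ⟩
          length (tree k u ++ ys)        ≡⟨ ↭-length p ⟩
          length (allFin n)              ≡⟨ length-tabulate (λ x → x) ⟩
          n                              ≡⟨ n≡ ⟩
          M 2 k + 2                      ∎))
        where open ≡-Reasoning
      ...   | a , b , refl = a , b , p

      order≢M+2 : n ≡ M 2 k + 2 → 3 ≤ k → ∀ {z₁ z₂ w₁ w₂} → z₁ ≢ z₂ → w₁ ≢ w₂ →
        (∀ f → ∑ (K f) (allFin n) + (f z₁ + f z₂)
             ≡ (∑ f (allFin n) + ∑ f (allFin n)) + (f w₁ + f w₂)) →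
        (∀ {z w} → z ≡ z₁ ⊎ z ≡ z₂ → w ≡ w₁ ⊎ w ≡ w₂ → z ≢ w) →
        (∀ {r} → ¬ (r ≡ z₁ ⊎ r ≡ z₂) → ∀ x → ∃[ s ] x ≢ s × s ⟶ r) →
        (∀ {w} → w ≡ w₁ ⊎ w ≡ w₂ → z₁ ⟶ w → z₂ ⟶ w →
           ∃[ a ] a ⟶ w × ¬ (a ≡ z₁ ⊎ a ≡ z₂) × (∀ {x} → x ⟶ w → (x ≡ z₁ ⊎ x ≡ z₂) ⊎ x ≡ a)) →
        ⊥
      order≢M+2 n≡ 3≤k z₁≢z₂ w₁≢w₂ handshake z≢w another-in third-in =
        Excess.no-excess-two 3≤k (λ u → proj₁ (outliers n≡ u)) (λ u → proj₁ (proj₂ (outliers n≡ u)))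
          (λ u → proj₂ (proj₂ (outliers n≡ u))) z₁≢z₂ w₁≢w₂ handshake
          (λ z → z≢w z (inj₁ refl)) (λ z → z≢w z (inj₂ refl)) another-in
          (λ w zw → third-in w (zw (inj₁ refl)) (zw (inj₂ refl)))

-- Degree counting.

module Degrees (A : Digraph n) where

  outNbrs inNbrs : Fin n → List (Fin n)
  outNbrs u = filterᵇ (A u) (allFin n)
  inNbrs v  = filterᵇ (λ u → A u v) (allFin n)

  withInDeg : ℕ → List (Fin n)
  withInDeg d = filterᵇ (λ v → inDeg A v ≡ᵇ d) (allFin n)

  filterᵇ-∈⁺ : ∀ (p : Fin n → Bool) {v} → T (p v) → v ∈ filterᵇ p (allFin n)
  filterᵇ-∈⁺ p pv = ∈-filter⁺ (T? ∘ p) (∈-allFin _) pv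

  filterᵇ-∈⁻ : ∀ (p : Fin n → Bool) {v} → v ∈ filterᵇ p (allFin n) → T (p v)
  filterᵇ-∈⁻ p v∈ = proj₂ (∈-filter⁻ (T? ∘ p) {xs = allFin n} v∈)

  filterᵇ-unique : ∀ (p : Fin n → Bool) → Unique (filterᵇ p (allFin n))
  filterᵇ-unique p = filter⁺ (T? ∘ p) (allFin⁺ n)

  ∈-withInDeg⁻ : ∀ {d v} → v ∈ withInDeg d → inDeg A v ≡ d
  ∈-withInDeg⁻ {d} {v} v∈ = ≡ᵇ⇒≡ (inDeg A v) d (filterᵇ-∈⁻ _ v∈)

  ∈-withInDeg⁺ : ∀ {d v} → inDeg A v ≡ d → v ∈ withInDeg d
  ∈-withInDeg⁺ {d} {v} eq = filterᵇ-∈⁺ _ (≡⇒≡ᵇ (inDeg A v) d eq)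

  length-withInDeg : ∀ d → length (withInDeg d) ≡ numInDeg A d
  length-withInDeg d = length-filter (λ v → inDeg A v ≡ᵇ d) (allFin n)

  -- Double counting of the arcs, each weighted by `f` at its head.
  ∑-outNbrs : ∀ f → ∑ (λ u → ∑ f (outNbrs u)) (allFin n) ≡ ∑ (λ v → inDeg A v * f v) (allFin n)
  ∑-outNbrs f = begin
    ∑ (λ u → ∑ f (outNbrs u)) (allFin n)
      ≡⟨ ∑-cong (λ u → ∑-filter f (A u) (allFin n)) (allFin n) ⟩
    ∑ (λ u → ∑ (λ v → b2n (A u v) * f v) (allFin n)) (allFin n)
      ≡⟨ ∑-swap (λ u v → b2n (A u v) * f v) (allFin n) (allFin n) ⟩
    ∑ (λ v → ∑ (λ u → b2n (A u v) * f v) (allFin n)) (allFin n)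
      ≡⟨ ∑-cong (λ v → ∑-*ʳ (λ u → b2n (A u v)) (f v) (allFin n)) (allFin n) ⟩
    ∑ (λ v → inDeg A v * f v) (allFin n) ∎
    where open ≡-Reasoning

  another-inNbr : ∀ {r} → 2 ≤ inDeg A r → ∀ x → ∃[ s ] x ≢ s × T (A s r)
  another-inNbr {r} 2≤d x =
    pick (filterᵇ-unique (λ u → A u r))
         (≤-trans 2≤d (≤-reflexive (sym (length-filter (λ u → A u r) (allFin n)))))
         (filterᵇ-∈⁻ (λ u → A u r))
    where
    pick : ∀ {xs} → Unique xs → 2 ≤ length xs → (∀ {s} → s ∈ xs → T (A s r)) →
      ∃[ s ] x ≢ s × T (A s r)
    pick {s ∷ []}     u (s≤s ()) arcs
    pick {s ∷ t ∷ xs} ((s≢t ∷ _) ∷ _) le arcs with x ≟ s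
    ... | yes refl = t , s≢t , arcs (there (here refl))
    ... | no x≢s   = s , x≢s , arcs (here refl)

  third-inNbr : ∀ {w x y} → inDeg A w ≡ 3 → x ≢ y → T (A x w) → T (A y w) →
    ∃[ a ] T (A a w) × ¬ (a ≡ x ⊎ a ≡ y) × (∀ {v} → T (A v w) → (v ≡ x ⊎ v ≡ y) ⊎ v ≡ a)
  third-inNbr {w} {x} {y} d x≢y xw yw =
    let ys , p = unique-⊆-complement ((x≢y ∷ []) ∷ [] ∷ []) sub
    in finish ys p (suc-injective (suc-injective
         (trans (↭-length p) (trans (length-filter (λ u → A u w) (allFin n)) d))))
    where
    sub : ∀ {v} → v ∈ x ∷ y ∷ [] → v ∈ inNbrs w
    sub (here refl)         = filterᵇ-∈⁺ _ xw
    sub (there (here refl)) = filterᵇ-∈⁺ _ yw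

    finish : ∀ ys → x ∷ y ∷ ys ↭ inNbrs w → length ys ≡ 1 →
      ∃[ a ] T (A a w) × ¬ (a ≡ x ⊎ a ≡ y) × (∀ {v} → T (A v w) → (v ≡ x ⊎ v ≡ y) ⊎ v ≡ a)
    finish (a ∷ []) p refl =
      a , filterᵇ-∈⁻ _ (∈-resp-↭ p (there (there (here refl)))) , a∉ , complete
      where
      a∉ : ¬ (a ≡ x ⊎ a ≡ y)
      a∉ a≡ with Unique-↭ (↭-sym p) (filterᵇ-unique (λ u → A u w)) | a≡
      ... | (_ ∷ x≢a ∷ []) ∷ _     | inj₁ a≡x = x≢a (sym a≡x)
      ... | _ ∷ (y≢a ∷ []) ∷ _     | inj₂ a≡y = y≢a (sym a≡y)

      complete : ∀ {v} → T (A v w) → (v ≡ x ⊎ v ≡ y) ⊎ v ≡ a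
      complete vw with ∈-resp-↭ (↭-sym p) (filterᵇ-∈⁺ (λ u → A u w) vw)
      ... | here v≡x                 = inj₁ (inj₁ v≡x)
      ... | there (here v≡y)         = inj₁ (inj₂ v≡y)
      ... | there (there (here v≡a)) = inj₂ v≡a

  module InSeq (inDeg-123 : ∀ v → inDeg A v ≡ 1 ⊎ inDeg A v ≡ 2 ⊎ inDeg A v ≡ 3)
               {z₁ z₂ w₁ w₂ : Fin n}
               (ones   : withInDeg 1 ≡ z₁ ∷ z₂ ∷ [])
               (threes : withInDeg 3 ≡ w₁ ∷ w₂ ∷ []) where

    -- Pointwise, the in-degree plus the indicator of in-degree 1 is 2 plus the indicator of
    -- in-degree 3.
    ∑-inDeg : ∀ f → ∑ (λ v → inDeg A v * f v) (allFin n) + (f z₁ + f z₂)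
                  ≡ (∑ f (allFin n) + ∑ f (allFin n)) + (f w₁ + f w₂)
    ∑-inDeg f = begin
      ∑ (λ v → inDeg A v * f v) (allFin n) + (f z₁ + f z₂)
        ≡⟨ cong (∑ (λ v → inDeg A v * f v) (allFin n) +_) (sym (indicator ones)) ⟩
      ∑ (λ v → inDeg A v * f v) (allFin n) + ∑ (λ v → b2n (inDeg A v ≡ᵇ 1) * f v) (allFin n)
        ≡⟨ sym (∑-+ _ _ (allFin n)) ⟩
      ∑ (λ v → inDeg A v * f v + b2n (inDeg A v ≡ᵇ 1) * f v) (allFin n)
        ≡⟨ ∑-cong (λ v → pointwise (inDeg A v) (f v) (inDeg-123 v)) (allFin n) ⟩
      ∑ (λ v → (f v + f v) + b2n (inDeg A v ≡ᵇ 3) * f v) (allFin n)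
        ≡⟨ ∑-+ (λ v → f v + f v) _ (allFin n) ⟩
      ∑ (λ v → f v + f v) (allFin n) + ∑ (λ v → b2n (inDeg A v ≡ᵇ 3) * f v) (allFin n)
        ≡⟨ cong₂ _+_ (∑-+ f f (allFin n)) (indicator threes) ⟩
      (∑ f (allFin n) + ∑ f (allFin n)) + (f w₁ + f w₂) ∎
      where
      open ≡-Reasoning
      indicator : ∀ {d x y} → withInDeg d ≡ x ∷ y ∷ [] →
        ∑ (λ v → b2n (inDeg A v ≡ᵇ d) * f v) (allFin n) ≡ f x + f y
      indicator {d} {x} {y} eq = begin
        ∑ (λ v → b2n (inDeg A v ≡ᵇ d) * f v) (allFin n) ≡⟨ sym (∑-filter f _ (allFin n)) ⟩
        ∑ f (withInDeg d)                               ≡⟨ cong (∑ f) eq ⟩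
        f x + (f y + 0)                                 ≡⟨ cong (f x +_) (+-identityʳ (f y)) ⟩
        f x + f y                                       ∎
      pointwise : ∀ d x → d ≡ 1 ⊎ d ≡ 2 ⊎ d ≡ 3 →
        d * x + b2n (d ≡ᵇ 1) * x ≡ (x + x) + b2n (d ≡ᵇ 3) * x
      pointwise .1 x (inj₁ refl)        = lemma x
        where
        lemma : ∀ x → (x + 0) + (x + 0) ≡ (x + x) + 0
        lemma = solve-∀
      pointwise .2 x (inj₂ (inj₁ refl)) = lemma x
        where
        lemma : ∀ x → (x + (x + 0)) + 0 ≡ (x + x) + 0
        lemma = solve-∀
      pointwise .3 x (inj₂ (inj₂ refl)) = lemma x
        where
        lemma : ∀ x → (x + (x + (x + 0))) + 0 ≡ (x + x) + (x + 0)
        lemma = solve-∀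

    -- At `f = 1` the excess and the deficit of the in-degrees cancel, so the out-degrees average
    -- exactly 2.
    outDeg≤2 : (∀ v → 2 ≤ outDeg A v) → ∀ u → outDeg A u ≤ 2
    outDeg≤2 2≤out u = ∑-tight 2≤out (≤-reflexive total) (∈-allFin u)
      where
      open ≡-Reasoning
      total : ∑ (outDeg A) (allFin n) ≡ ∑ (λ _ → 2) (allFin n)
      total = +-cancelʳ-≡ 2 _ _ (begin
        ∑ (outDeg A) (allFin n) + 2
          ≡⟨ cong (_+ 2) (∑-cong (λ u → sym (trans
               (∑-filter (λ _ → 1) (A u) (allFin n))
               (∑-cong (λ v → *-identityʳ (b2n (A u v))) (allFin n)))) (allFin n)) ⟩
        ∑ (λ u → ∑ (λ _ → 1) (outNbrs u)) (allFin n) + 2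
          ≡⟨ cong (_+ 2) (∑-outNbrs (λ _ → 1)) ⟩
        ∑ (λ v → inDeg A v * 1) (allFin n) + 2
          ≡⟨ ∑-inDeg (λ _ → 1) ⟩
        (∑ (λ _ → 1) (allFin n) + ∑ (λ _ → 1) (allFin n)) + 2
          ≡⟨ cong (_+ 2) (sym (∑-+ (λ _ → 1) (λ _ → 1) (allFin n))) ⟩
        ∑ (λ _ → 2) (allFin n) + 2 ∎)

    z₁≢z₂ : z₁ ≢ z₂
    z₁≢z₂ with (z₁≢z₂ ∷ _) ∷ _ ← subst Unique ones (filterᵇ-unique _) = z₁≢z₂

    w₁≢w₂ : w₁ ≢ w₂
    w₁≢w₂ with (w₁≢w₂ ∷ _) ∷ _ ← subst Unique threes (filterᵇ-unique _) = w₁≢w₂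

    inDeg-w : ∀ {w} → w ≡ w₁ ⊎ w ≡ w₂ → inDeg A w ≡ 3
    inDeg-w w≡ = ∈-withInDeg⁻ (subst (_ ∈_) (sym threes) ([ here , there ∘ here ]′ w≡))

    inDeg-z : ∀ {z} → z ≡ z₁ ⊎ z ≡ z₂ → inDeg A z ≡ 1
    inDeg-z z≡ = ∈-withInDeg⁻ (subst (_ ∈_) (sym ones) ([ here , there ∘ here ]′ z≡))

    z≢w : ∀ {z w} → z ≡ z₁ ⊎ z ≡ z₂ → w ≡ w₁ ⊎ w ≡ w₂ → z ≢ w
    z≢w z≡ w≡ refl with () ← trans (sym (inDeg-z z≡)) (inDeg-w w≡)

    2≤inDeg : ∀ {r} → ¬ (r ≡ z₁ ⊎ r ≡ z₂) → 2 ≤ inDeg A r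
    2≤inDeg {r} r∉ with inDeg-123 r
    ... | inj₂ (inj₁ d) = ≤-reflexive (sym d)
    ... | inj₂ (inj₂ d) = ≤-trans (n≤1+n 2) (≤-reflexive (sym d))
    ... | inj₁ d with subst (r ∈_) ones (∈-withInDeg⁺ d)
    ...   | here r≡z₁         = contradiction (inj₁ r≡z₁) r∉
    ...   | there (here r≡z₂) = contradiction (inj₂ r≡z₂) r∉

-- From the in-degree sequence to the outlier argument.

module TwoOutNeighbours
  {k : ℕ} (3≤k : 3 ≤ k) (A : Digraph (M 2 k + 2)) (geo : KGeodetic A k)
  (inDeg-123 : ∀ v → inDeg A v ≡ 1 ⊎ inDeg A v ≡ 2 ⊎ inDeg A v ≡ 3)
  {z₁ z₂ w₁ w₂ : Fin (M 2 k + 2)}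
  (ones   : Degrees.withInDeg A 1 ≡ z₁ ∷ z₂ ∷ [])
  (threes : Degrees.withInDeg A 3 ≡ w₁ ∷ w₂ ∷ [])
  (κ₁ κ₂ : Fin (M 2 k + 2) → Fin (M 2 k + 2))
  (outNbrs-κ : ∀ u → Degrees.outNbrs A u ≡ κ₁ u ∷ κ₂ u ∷ [])
  where

  open Degrees A

  open InSeq inDeg-123 ones threes

  κ-arc : ∀ u {v} → v ∈ κ₁ u ∷ κ₂ u ∷ [] → T (A u v)
  κ-arc u v∈ = filterᵇ-∈⁻ (A u) (subst (_ ∈_) (sym (outNbrs-κ u)) v∈)

  κ₁≢κ₂ : ∀ u → κ₁ u ≢ κ₂ u
  κ₁≢κ₂ u with (κ₁≢κ₂ ∷ _) ∷ _ ← subst Unique (outNbrs-κ u) (filterᵇ-unique (A u)) = κ₁≢κ₂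

  κ-complete : ∀ {u v} → T (A u v) → v ≡ κ₁ u ⊎ v ≡ κ₂ u
  κ-complete {u} uv with subst (_ ∈_) (outNbrs-κ u) (filterᵇ-∈⁺ (A u) uv)
  ... | here v≡         = inj₁ v≡
  ... | there (here v≡) = inj₂ v≡

  handshake : ∀ f → ∑ (λ u → f (κ₁ u) + f (κ₂ u)) (allFin _) + (f z₁ + f z₂)
                  ≡ (∑ f (allFin _) + ∑ f (allFin _)) + (f w₁ + f w₂)
  handshake f =
    trans (cong (_+ (f z₁ + f z₂)) (trans (∑-cong out (allFin _)) (∑-outNbrs f))) (∑-inDeg f)
    where
    out : ∀ u → f (κ₁ u) + f (κ₂ u) ≡ ∑ f (outNbrs u)
    out u = sym (trans (cong (∑ f) (outNbrs-κ u)) (cong (f (κ₁ u) +_) (+-identityʳ (f (κ₂ u)))))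

  contra : ⊥
  contra = Paths.Binary.GeodeticBinary.order≢M+2 A κ₁ κ₂
    (λ u → κ-arc u (here refl)) (λ u → κ-arc u (there (here refl))) κ₁≢κ₂ κ-complete geo
    refl 3≤k z₁≢z₂ w₁≢w₂ handshake z≢w (λ r∉ → another-inNbr (2≤inDeg r∉))
    (λ w → third-inNbr (inDeg-w w) z₁≢z₂)

theorem6 : (k : ℕ) → 3 ≤ k → (A : Digraph (M 2 k + 2)) →
    KGeodetic A k → (∀ v → 2 ≤ outDeg A v) → ¬ InSeq11233 A
theorem6 k 3≤k A geo 2≤out (inDeg-123 , ones , threes) =
  let _ , _ , ones′   = length-2 (withInDeg 1) (trans (length-withInDeg 1) ones)
      _ , _ , threes′ = length-2 (withInDeg 3) (trans (length-withInDeg 3) threes)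
      outNbrs-2 u = length-2 (outNbrs u)
        (trans (length-filter (A u) (allFin (M 2 k + 2)))
               (≤-antisym (InSeq.outDeg≤2 inDeg-123 ones′ threes′ 2≤out u) (2≤out u)))
  in TwoOutNeighbours.contra 3≤k A geo inDeg-123 ones′ threes′
       (λ u → proj₁ (outNbrs-2 u)) (λ u → proj₁ (proj₂ (outNbrs-2 u)))
       (λ u → proj₂ (proj₂ (outNbrs-2 u)))
  where open Degrees A
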